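{- Let $K$ be a triangulated closed surface and let $\zeta$ be a nontrivial (non-bounding) $1$-cycle of $K$ with $\mathbb{Z}_2$ coefficients. Then every minimal solution set of Topological Hitting Set for $\zeta$ is (the set of edges of) a nontrivial $1$-cocycle of $K$.
   Context: Homology and cohomology are simplicial with $\mathbb{Z}_2$ coefficients; $p$-chains and $p$-cochains are identified with sets of $p$-simplices. A solution set of Topological Hitting Set for $\zeta$ is a set $S$ of edges of $K$ such that every $1$-cycle homologous to $\zeta$ contains at least one edge of $S$. A solution set is minimal if no proper subset of it is a solution set. A cocycle is nontrivial if it is not a coboundary. -}

module Defs where

open import Level using (0ℓ)
open import Algebra.Bundles using (CommutativeRing)
open import Data.Bool.Base using (Bool; true; false; not; _∧_; _xor_)
open import Data.Bool.Properties using (xor-∧-commutativeRing)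
open import Data.Fin.Base using (Fin; toℕ)
open import Data.Fin.Subset
  using (Subset; Nonempty; ⁅_⁆; _∈_; _∉_; _⊆_; _∪_; _-_; ∣_∣)
open import Data.Nat.Base using (ℕ; suc; _+_)
open import Data.Nat.DivMod using (_mod_)
import Data.Nat.Properties as ℕ
open import Data.Product.Base using (∃; _×_)
open import Data.Sum.Base using (_⊎_)
open import Data.Vec.Base using (lookup)
open import Function.Bundles using (_⇔_)
open import Function.Definitions using (Injective)
open import Relation.Binary.PropositionalEquality using (_≡_)
open import Relation.Nullary using (¬_; Dec; yes; does)
open import Relation.Nullary.Decidable using (_×-dec_)
open import Relation.Unary using (Pred; Decidable)

-- Summation over Fin n in the additive group of ℤ₂ = (Bool, xor).
open import Algebra.Properties.CommutativeMonoid.Sum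
  (CommutativeRing.+-commutativeMonoid xor-∧-commutativeRing)
  using (sum)

-- Finite abstract simplicial complexes with vertex set Fin n; the empty
-- set is not counted as a simplex.
record SimplicialComplex (n : ℕ) : Set₁ where
  field
    Face        : Pred (Subset n) 0ℓ
    face?       : Decidable Face
    nonempty    : ∀ {σ} → Face σ → Nonempty σ
    down-closed : ∀ {σ τ} → Face σ → Nonempty τ → τ ⊆ σ → Face τ
    vertex      : ∀ v → Face ⁅ v ⁆

next : ∀ {m} → Fin (3 + m) → Fin (3 + m)
next {m} i = suc (toℕ i) mod (3 + m)

-- The family L of simplices is a triangulated circle: the vertices and
-- edges of a closed polygon w 0, w 1, …, w (m + 2) with at least three
-- distinct vertices.
IsCircle : ∀ {n} → Pred (Subset n) 0ℓ → Set
IsCircle {n} L =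
  ∃ λ m → ∃ λ (w : Fin (3 + m) → Fin n) →
    Injective _≡_ _≡_ w ×
    (∀ τ → L τ ⇔ ∃ λ i → (τ ≡ ⁅ w i ⁆) ⊎ (τ ≡ ⁅ w i ⁆ ∪ ⁅ w (next i) ⁆))

module _ {n : ℕ} (K : SimplicialComplex n) where
  open SimplicialComplex K

  Link : Fin n → Pred (Subset n) 0ℓ
  Link v τ = Nonempty τ × v ∉ τ × Face (τ ∪ ⁅ v ⁆)

  -- The combinatorial form of "the underlying space of K is a compact
  -- 2-manifold without boundary".  It forces K to be pure of dimension 2
  -- with every edge in exactly two triangles.  Connectedness is not assumed.
  IsClosedSurface : Set
  IsClosedSurface = ∀ v → IsCircle (Link v)

  Simplex : ℕ → Pred (Subset n) 0ℓ
  Simplex p σ = Face σ × ∣ σ ∣ ≡ suc p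

  simplex? : ∀ p → Decidable (Simplex p)
  simplex? p σ = face? σ ×-dec (∣ σ ∣ ℕ.≟ suc p)

  -- A p-chain, equally a p-cochain, is a set of p-simplices of K, given by
  -- its characteristic function.
  record Chain (p : ℕ) : Set where
    field
      coeff     : Subset n → Bool
      supported : ∀ {σ} → coeff σ ≡ true → Simplex p σ

  open Chain public

  module _ {p : ℕ} where

    _∈ᶜ_ : Subset n → Chain p → Set
    σ ∈ᶜ c = coeff c σ ≡ true

    _⊆ᶜ_ : Chain p → Chain p → Set
    c ⊆ᶜ d = ∀ {σ} → σ ∈ᶜ c → σ ∈ᶜ d

    _⊂ᶜ_ : Chain p → Chain p → Set
    c ⊂ᶜ d = c ⊆ᶜ d × ∃ λ σ → σ ∈ᶜ d × ¬ (σ ∈ᶜ c)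

    _≈ᶜ_ : Chain p → Chain p → Set
    c ≈ᶜ d = ∀ σ → coeff c σ ≡ coeff d σ

  -- The p-chain that agrees with f on the p-simplices of K.
  restrict : ∀ p → (Subset n → Bool) → Chain p
  restrict p f .coeff σ = does (simplex? p σ) ∧ f σ
  restrict p f .supported {σ} = witness (simplex? p σ)
    where
    witness : ∀ {A : Set} (a? : Dec A) {b} → does a? ∧ b ≡ true → A
    witness (yes a) _ = a

  0ᶜ : ∀ {p} → Chain p
  0ᶜ {p} = restrict p (λ _ → false)

  _+ᶜ_ : ∀ {p} → Chain p → Chain p → Chain p
  _+ᶜ_ {p} c d = restrict p (λ σ → coeff c σ xor coeff d σ)

  -- The coefficient of ∂ c at τ counts, mod 2, the simplices of c having τ
  -- as a facet; these are of the form τ ∪ {v} with v ∉ τ.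
  ∂ : ∀ {p} → Chain (suc p) → Chain p
  ∂ {p} c = restrict p λ τ →
    sum λ v → not (lookup τ v) ∧ coeff c (τ ∪ ⁅ v ⁆)

  -- (δ c)(σ) = c(∂ σ), where the facets of σ are the sets σ - v with v ∈ σ.
  δ : ∀ {p} → Chain p → Chain (suc p)
  δ {p} c = restrict (suc p) λ σ →
    sum λ v → lookup σ v ∧ coeff c (σ - v)

  module _ {p : ℕ} where

    IsCycle IsBoundary IsNontrivialCycle : Chain (suc p) → Set
    IsCycle c           = ∂ c ≈ᶜ 0ᶜ
    IsBoundary c        = ∃ λ (d : Chain (suc (suc p))) → ∂ d ≈ᶜ c
    IsNontrivialCycle c = IsCycle c × ¬ IsBoundary c

    Homologous : Chain (suc p) → Chain (suc p) → Set
    Homologous c d = IsBoundary (c +ᶜ d)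

    IsCocycle IsCoboundary IsNontrivialCocycle : Chain (suc p) → Set
    IsCocycle c           = δ c ≈ᶜ 0ᶜ
    IsCoboundary c        = ∃ λ (d : Chain p) → δ d ≈ᶜ c
    IsNontrivialCocycle c = IsCocycle c × ¬ IsCoboundary c

  IsSolutionSet : Chain 1 → Chain 1 → Set
  IsSolutionSet ζ S =
    ∀ (z : Chain 1) → IsCycle z → Homologous z ζ →
    ∃ λ e → e ∈ᶜ z × e ∈ᶜ S

  IsMinimalSolutionSet : Chain 1 → Chain 1 → Set
  IsMinimalSolutionSet ζ S =
    IsSolutionSet ζ S × (∀ S′ → S′ ⊂ᶜ S → ¬ IsSolutionSet ζ S′)

{-# OPTIONS --safe #-}
module Submission where

-- Write ⟨ c , d ⟩ for the mod 2 number of common simplices of c and d.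
-- The coboundary is adjoint to the boundary for this pairing (⟨⟩-δ-∂), so a
-- cocycle pairs equally with homologous cycles (cocycle-homologous), and a
-- coboundary pairs to zero with every cycle (coboundary-cycle).
--
-- Consequently every 1-cocycle η with ⟨ η , ζ ⟩ = 1 is a solution set: a
-- cycle z homologous to ζ has ⟨ η , z ⟩ = 1, so it shares an edge with η
-- (cocycle⇒solution).  Conversely, every solution set S contains such an η
-- (solution⇒cocycle).  Indeed, S ∩ ζ is not of the form S ∩ ∂ d, for
-- otherwise ζ + ∂ d would be a cycle homologous to ζ that avoids S (it is a
-- cycle by ∂-∂).  Hence, by linear algebra (separate), some functional φ
-- vanishes on all the chains S ∩ ∂ σ, with σ a triangle, but not on S ∩ ζ;
-- then η = φ ∩ S is contained in S, is a cocycle because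
-- (δ η)(σ) = ⟨ η , ∂ σ ⟩ = ⟨ φ , S ∩ ∂ σ ⟩ = 0, and satisfies ⟨ η , ζ ⟩ = 1.
--
-- If S is minimal, then S = η; so S is a cocycle, and it is nontrivial
-- because it pairs to 1 with the cycle ζ.

open import Defs
open import Data.Nat.Base using (ℕ)
open import Algebra.Bundles using (CommutativeRing)
open import Data.Bool.Base using (Bool; true; false; not; _∧_; _∨_; _xor_)
open import Data.Bool.Properties
  using (_≟_; ∧-comm; ∧-assoc; ∧-zeroʳ; ∧-distribˡ-xor;
         xor-comm; xor-assoc; xor-same; xor-identityʳ; ¬-not;
         xor-annihilates-not; not-distribˡ-xor; not-distribʳ-xor;
         xor-∧-commutativeRing)
open import Data.Fin.Base using (Fin; zero; suc)
open import Data.Fin.Subset using (Subset; Nonempty; inside; outside; ⊥; ⁅_⁆; _∪_; _-_; ∣_∣)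
open import Data.Fin.Subset.Properties
  using (anySubset?; ∪-identityʳ; ∪-assoc; ∪-comm; p─⊥≡p; p⊆p∪q; q⊆p∪q; x∈⁅x⁆)
open import Data.List.Base using (List; []; _∷_; _++_; map)
open import Data.List.Membership.Propositional using (_∈_)
open import Data.List.Membership.Propositional.Properties
  using (∈-map⁺; ∈-++⁺ˡ; ∈-++⁺ʳ)
open import Data.List.Relation.Unary.All as All using (All; []; _∷_)
import Data.List.Relation.Unary.All.Properties as All
open import Data.List.Relation.Unary.Any using (here)
import Data.Nat.Base as ℕ
import Data.Nat.Properties as ℕ
open import Data.Product.Base using (∃; _×_; _,_; proj₁; proj₂)
open import Data.Sum.Base using (_⊎_; inj₁; inj₂)
open import Data.Vec.Base using ([]; _∷_; lookup)
open import Data.Vec.Properties using (lookup-zipWith)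
open import Function.Base using (_∘_)
open import Relation.Binary.PropositionalEquality
  using (_≡_; refl; sym; trans; cong; cong₂; subst; module ≡-Reasoning)
open import Relation.Nullary using (¬_; yes; no; does; contradiction)
open import Relation.Nullary.Decidable using (dec-true)

open import Algebra.Properties.Semiring.Sum
  (CommutativeRing.semiring xor-∧-commutativeRing)
  using (sum; sum-cong-≗; sum-replicate-zero; ∑-distrib-+; *-distribˡ-sum; *-distribʳ-sum)

open ≡-Reasoning

-- Arithmetic of ℤ₂

xor-interchange : ∀ a b c d → (a xor b) xor (c xor d) ≡ (a xor c) xor (b xor d)
xor-interchange true  true  c d = sym (xor-annihilates-not c d)
xor-interchange true  false c d = not-distribˡ-xor c d
xor-interchange false true  c d = not-distribʳ-xor c d
xor-interchange false false c d = refl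

xor-cancelʳ : ∀ a b → (a xor b) xor b ≡ a
xor-cancelʳ a b = trans (xor-assoc a b b)
  (trans (cong (a xor_) (xor-same b)) (xor-identityʳ a))

xor≡false⇒≡ : ∀ {a b} → a xor b ≡ false → a ≡ b
xor≡false⇒≡ {true}  {true}  _ = refl
xor≡false⇒≡ {false} {false} _ = refl

∧-trueˡ : ∀ {a b} → a ∧ b ≡ true → a ≡ true
∧-trueˡ {true} _ = refl

∧-trueʳ : ∀ {a b} → a ∧ b ≡ true → b ≡ true
∧-trueʳ {true} e = e

-- A symmetric matrix with zero diagonal has sum zero.
sum-symmetric : ∀ {n} (a : Fin n → Fin n → Bool) →
  (∀ i j → a i j ≡ a j i) → (∀ i → a i i ≡ false) →
  sum (λ i → sum (a i)) ≡ false
sum-symmetric {ℕ.zero}  a a-sym a-diag = refl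
sum-symmetric {ℕ.suc n} a a-sym a-diag = begin
  (a zero zero xor row) xor sum (λ i → a (suc i) zero xor sum (a (suc i) ∘ suc))
    ≡⟨ cong₂ (λ x y → (x xor row) xor y) (a-diag zero)
         (∑-distrib-+ (λ i → a (suc i) zero) (λ i → sum (a (suc i) ∘ suc))) ⟩
  row xor (sum (λ i → a (suc i) zero) xor rest)
    ≡⟨ cong₂ (λ x y → row xor (x xor y)) (sum-cong-≗ (λ i → a-sym (suc i) zero))
         (sum-symmetric (λ i j → a (suc i) (suc j))
           (λ i j → a-sym (suc i) (suc j)) (λ i → a-diag (suc i))) ⟩
  row xor (row xor false)
    ≡⟨ cong (row xor_) (xor-identityʳ row) ⟩
  row xor row
    ≡⟨ xor-same row ⟩
  false ∎
  where
  row rest : Bool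
  row  = sum (λ j → a zero (suc j))
  rest = sum (λ i → sum (λ j → a (suc i) (suc j)))

sum-true : ∀ {n} (f : Fin n → Bool) → sum f ≡ true → ∃ λ i → f i ≡ true
sum-true {ℕ.suc n} f Σf with f zero in f0
... | true  = zero , f0
... | false = let i , fi = sum-true (f ∘ suc) Σf in suc i , fi

-- Functions on the subsets of a finite set, and their pairing

-- The vector space over ℤ₂ of all functions on the subsets of Fin n.
Vector : ℕ → Set
Vector n = Subset n → Bool

infixl 6 _⊕_
-- Vector addition: the symmetric difference of two families of subsets.
_⊕_ : ∀ {n} → Vector n → Vector n → Vector n
(f ⊕ g) σ = f σ xor g σ

infixl 7 _⊙_
-- Pointwise product: the intersection of two families of subsets.
_⊙_ : ∀ {n} → Vector n → Vector n → Vector n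
(f ⊙ g) σ = f σ ∧ g σ

-- Summation over all subsets of Fin n.
Σₛ : ∀ {n} → Vector n → Bool
Σₛ {ℕ.zero}  f = f []
Σₛ {ℕ.suc n} f = Σₛ (f ∘ (inside ∷_)) xor Σₛ (f ∘ (outside ∷_))

Σₛ-cong : ∀ {n} {f g : Vector n} → (∀ σ → f σ ≡ g σ) → Σₛ f ≡ Σₛ g
Σₛ-cong {ℕ.zero}  f≗g = f≗g []
Σₛ-cong {ℕ.suc n} f≗g = cong₂ _xor_ (Σₛ-cong (f≗g ∘ (inside ∷_))) (Σₛ-cong (f≗g ∘ (outside ∷_)))

Σₛ-zero : ∀ n → Σₛ {n} (λ _ → false) ≡ false
Σₛ-zero ℕ.zero    = refl
Σₛ-zero (ℕ.suc n) = cong₂ _xor_ (Σₛ-zero n) (Σₛ-zero n)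

Σₛ-⊕ : ∀ {n} (f g : Vector n) → Σₛ (f ⊕ g) ≡ Σₛ f xor Σₛ g
Σₛ-⊕ {ℕ.zero}  f g = refl
Σₛ-⊕ {ℕ.suc n} f g = trans
  (cong₂ _xor_ (Σₛ-⊕ (f ∘ (inside ∷_)) (g ∘ (inside ∷_)))
               (Σₛ-⊕ (f ∘ (outside ∷_)) (g ∘ (outside ∷_))))
  (xor-interchange (Σₛ (f ∘ (inside ∷_))) _ _ _)

Σₛ-sum : ∀ {n m} (f : Subset n → Fin m → Bool) →
  Σₛ (λ σ → sum (f σ)) ≡ sum (λ i → Σₛ (λ σ → f σ i))
Σₛ-sum {ℕ.zero}  f = refl
Σₛ-sum {ℕ.suc n} f = trans
  (cong₂ _xor_ (Σₛ-sum (f ∘ (inside ∷_))) (Σₛ-sum (f ∘ (outside ∷_))))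
  (sym (∑-distrib-+ (λ i → Σₛ (λ σ → f (inside ∷ σ) i)) _))

Σₛ-true : ∀ {n} {f : Vector n} → Σₛ f ≡ true → ∃ λ σ → f σ ≡ true
Σₛ-true {n} {f} Σf with anySubset? (λ σ → f σ ≟ true)
... | yes e = e
... | no ∄σ = contradiction (trans (sym Σf) (trans (Σₛ-cong f≗0) (Σₛ-zero n))) λ ()
  where
  f≗0 : ∀ σ → f σ ≡ false
  f≗0 σ = ¬-not (λ fσ → ∄σ (σ , fσ))

-- The pairing of functions on subsets: for characteristic functions, the
-- parity of the number of common members.
⟨_,_⟩ : ∀ {n} → Vector n → Vector n → Bool
⟨ f , g ⟩ = Σₛ (f ⊙ g)

⟨⟩-comm : ∀ {n} (f g : Vector n) → ⟨ f , g ⟩ ≡ ⟨ g , f ⟩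
⟨⟩-comm f g = Σₛ-cong (λ σ → ∧-comm (f σ) (g σ))

⟨⟩-⊕ʳ : ∀ {n} (f g h : Vector n) → ⟨ f , g ⊕ h ⟩ ≡ ⟨ f , g ⟩ xor ⟨ f , h ⟩
⟨⟩-⊕ʳ f g h = trans (Σₛ-cong (λ σ → ∧-distribˡ-xor (f σ) (g σ) (h σ))) (Σₛ-⊕ (f ⊙ g) (f ⊙ h))

⟨⟩-⊕ˡ : ∀ {n} (f g h : Vector n) → ⟨ f ⊕ g , h ⟩ ≡ ⟨ f , h ⟩ xor ⟨ g , h ⟩
⟨⟩-⊕ˡ f g h = trans (⟨⟩-comm (f ⊕ g) h)
  (trans (⟨⟩-⊕ʳ h f g) (cong₂ _xor_ (⟨⟩-comm h f) (⟨⟩-comm h g)))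

⟨⟩-zeroʳ : ∀ {n} (f g : Vector n) → (∀ σ → g σ ≡ false) → ⟨ f , g ⟩ ≡ false
⟨⟩-zeroʳ {n} f g g≗0 =
  trans (Σₛ-cong (λ σ → trans (cong (f σ ∧_) (g≗0 σ)) (∧-zeroʳ (f σ)))) (Σₛ-zero n)

-- The characteristic function of the single subset σ.
single : ∀ {n} → Subset n → Vector n
single []            []            = true
single (inside  ∷ σ) (inside  ∷ τ) = single σ τ
single (inside  ∷ σ) (outside ∷ τ) = false
single (outside ∷ σ) (inside  ∷ τ) = false
single (outside ∷ σ) (outside ∷ τ) = single σ τ

⟨⟩-single : ∀ {n} (σ : Subset n) (f : Vector n) → ⟨ single σ , f ⟩ ≡ f σ
⟨⟩-single []                        f = refl
⟨⟩-single {ℕ.suc n} (inside  ∷ σ) f =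
  trans (cong₂ _xor_ (⟨⟩-single σ (f ∘ (inside ∷_))) (Σₛ-zero n)) (xor-identityʳ _)
⟨⟩-single {ℕ.suc n} (outside ∷ σ) f =
  cong₂ _xor_ (Σₛ-zero n) (⟨⟩-single σ (f ∘ (outside ∷_)))

-- Duality in a finite-dimensional space over ℤ₂

-- P is a linear subspace.  Closure under scalar multiplication follows from
-- zero∈, since the only scalars are 0 and 1.  Vectors are compared pointwise, which is why resp is
-- required.
record IsSubspace {n} (P : Vector n → Set) : Set where
  field
    resp  : ∀ {f g} → (∀ σ → f σ ≡ g σ) → P f → P g
    zero∈ : P (λ _ → false)
    ⊕∈    : ∀ {f g} → P f → P g → P (f ⊕ g)

-- Separation of a vector f from finitely many vectors gs of a subspace P:
-- if f is not in P, some functional φ kills gs but not f.  The induction on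
-- gs takes a φ that kills the tail but not f.  If φ does not kill the head g,
-- take a ψ that kills the tail but not f ⊕ g (if f ⊕ g is in P, so is f).
-- If ψ kills g, then ψ does not kill f; otherwise ψ kills f, and φ ⊕ ψ is as required.
separate : ∀ {n} {P : Vector n → Set} → IsSubspace P →
  ∀ gs → All P gs → ∀ f →
  P f ⊎ ∃ λ φ → All (λ g → ⟨ φ , g ⟩ ≡ false) gs × ⟨ φ , f ⟩ ≡ true
separate sub [] [] f with anySubset? (λ σ → f σ ≟ true)
... | yes (σ , fσ) = inj₂ (single σ , [] , trans (⟨⟩-single σ f) fσ)
... | no ∄σ = inj₁ (resp (λ σ → sym (¬-not (λ fσ → ∄σ (σ , fσ)))) zero∈)
  where open IsSubspace sub
separate sub (g ∷ gs) (Pg ∷ Pgs) f with separate sub gs Pgs f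
... | inj₁ Pf = inj₁ Pf
... | inj₂ (φ , φgs , φf) with ⟨ φ , g ⟩ in φg
...   | false = inj₂ (φ , φg ∷ φgs , φf)
...   | true with separate sub gs Pgs (f ⊕ g)
...     | inj₁ Pf⊕g = inj₁ (resp (λ σ → xor-cancelʳ (f σ) (g σ)) (⊕∈ Pf⊕g Pg))
  where open IsSubspace sub
...     | inj₂ (ψ , ψgs , ψf⊕g) with ⟨ ψ , g ⟩ in ψg
...       | false = inj₂ (ψ , ψg ∷ ψgs , ψf)
  where
  ψf : ⟨ ψ , f ⟩ ≡ true
  ψf = begin
    ⟨ ψ , f ⟩                 ≡⟨ xor-identityʳ _ ⟨
    ⟨ ψ , f ⟩ xor false       ≡⟨ cong (⟨ ψ , f ⟩ xor_) ψg ⟨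
    ⟨ ψ , f ⟩ xor ⟨ ψ , g ⟩   ≡⟨ ⟨⟩-⊕ʳ ψ f g ⟨
    ⟨ ψ , f ⊕ g ⟩             ≡⟨ ψf⊕g ⟩
    true                      ∎
...       | true  = inj₂ (φ ⊕ ψ , φψg ∷ All.zipWith (λ (p , q) → combine p q) (φgs , ψgs) , φψf)
  where
  combine : ∀ {h a b} → ⟨ φ , h ⟩ ≡ a → ⟨ ψ , h ⟩ ≡ b → ⟨ φ ⊕ ψ , h ⟩ ≡ a xor b
  combine {h} φh ψh = trans (⟨⟩-⊕ˡ φ ψ h) (cong₂ _xor_ φh ψh)
  ψf : ⟨ ψ , f ⟩ ≡ false
  ψf = begin
    ⟨ ψ , f ⟩                              ≡⟨ xor-cancelʳ _ true ⟨
    (⟨ ψ , f ⟩ xor true) xor true          ≡⟨ cong (λ x → (⟨ ψ , f ⟩ xor x) xor true) ψg ⟨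
    (⟨ ψ , f ⟩ xor ⟨ ψ , g ⟩) xor true     ≡⟨ cong (_xor true) (⟨⟩-⊕ʳ ψ f g) ⟨
    ⟨ ψ , f ⊕ g ⟩ xor true                 ≡⟨ cong (_xor true) ψf⊕g ⟩
    false                                  ∎
  φψg : ⟨ φ ⊕ ψ , g ⟩ ≡ false
  φψg = combine φg ψg
  φψf : ⟨ φ ⊕ ψ , f ⟩ ≡ true
  φψf = combine φf ψf

-- The list of all subsets of Fin n.
subsets : ∀ n → List (Subset n)
subsets ℕ.zero    = [] ∷ []
subsets (ℕ.suc n) = map (inside ∷_) (subsets n) ++ map (outside ∷_) (subsets n)

∈-subsets : ∀ {n} (σ : Subset n) → σ ∈ subsets n
∈-subsets []            = here refl
∈-subsets (inside  ∷ σ) = ∈-++⁺ˡ (∈-map⁺ (inside ∷_) (∈-subsets σ))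
∈-subsets (outside ∷ σ) = ∈-++⁺ʳ _ (∈-map⁺ (outside ∷_) (∈-subsets σ))

-- Boundary and coboundary of arbitrary functions on subsets

-- The formulas for ∂ and δ, on all functions on subsets and without the
-- restriction to simplices of a given dimension.
∂₀ δ₀ : ∀ {n} → Vector n → Vector n
∂₀ f τ = sum λ v → not (lookup τ v) ∧ f (τ ∪ ⁅ v ⁆)
δ₀ f σ = sum λ v → lookup σ v ∧ f (σ - v)

-- For fixed v, removing v is a bijection from the subsets containing v to
-- those avoiding it, with inverse inserting v.
Σₛ-remove-insert : ∀ {n} (v : Fin n) (f g : Vector n) →
  Σₛ (λ σ → f σ ∧ (lookup σ v ∧ g (σ - v))) ≡
  Σₛ (λ τ → (not (lookup τ v) ∧ f (τ ∪ ⁅ v ⁆)) ∧ g τ)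
Σₛ-remove-insert {ℕ.suc n} zero f g = begin
  Σₛ (λ σ → f (inside ∷ σ) ∧ g ((inside ∷ σ) - zero)) xor Σₛ (λ σ → f (outside ∷ σ) ∧ false)
    ≡⟨ cong₂ _xor_
         (Σₛ-cong (λ σ → cong₂ (λ x y → f (inside ∷ x) ∧ g (outside ∷ y))
           (sym (∪-identityʳ σ)) (p─⊥≡p σ)))
         (trans (Σₛ-cong (λ σ → ∧-zeroʳ (f (outside ∷ σ)))) (Σₛ-zero n)) ⟩
  RHS xor false
    ≡⟨ xor-comm RHS false ⟩
  false xor RHS
    ≡⟨ cong (_xor RHS) (Σₛ-zero n) ⟨
  Σₛ {n} (λ _ → false) xor RHS ∎
  where
  RHS : Bool
  RHS = Σₛ (λ τ → f ((outside ∷ τ) ∪ ⁅ zero ⁆) ∧ g (outside ∷ τ))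
Σₛ-remove-insert (suc v) f g = cong₂ _xor_
  (Σₛ-remove-insert v (f ∘ (inside ∷_)) (g ∘ (inside ∷_)))
  (Σₛ-remove-insert v (f ∘ (outside ∷_)) (g ∘ (outside ∷_)))

⟨⟩-δ₀-∂₀ : ∀ {n} (f g : Vector n) → ⟨ f , δ₀ g ⟩ ≡ ⟨ ∂₀ f , g ⟩
⟨⟩-δ₀-∂₀ f g = begin
  Σₛ (λ σ → f σ ∧ sum (λ v → lookup σ v ∧ g (σ - v)))
    ≡⟨ Σₛ-cong (λ σ → *-distribˡ-sum (f σ) (λ v → lookup σ v ∧ g (σ - v))) ⟩
  Σₛ (λ σ → sum (λ v → f σ ∧ (lookup σ v ∧ g (σ - v))))
    ≡⟨ Σₛ-sum (λ σ v → f σ ∧ (lookup σ v ∧ g (σ - v))) ⟩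
  sum (λ v → Σₛ (λ σ → f σ ∧ (lookup σ v ∧ g (σ - v))))
    ≡⟨ sum-cong-≗ (λ v → Σₛ-remove-insert v f g) ⟩
  sum (λ v → Σₛ (λ τ → (not (lookup τ v) ∧ f (τ ∪ ⁅ v ⁆)) ∧ g τ))
    ≡⟨ Σₛ-sum (λ τ v → (not (lookup τ v) ∧ f (τ ∪ ⁅ v ⁆)) ∧ g τ) ⟨
  Σₛ (λ τ → sum (λ v → (not (lookup τ v) ∧ f (τ ∪ ⁅ v ⁆)) ∧ g τ))
    ≡⟨ Σₛ-cong (λ τ → *-distribʳ-sum (g τ) (λ v → not (lookup τ v) ∧ f (τ ∪ ⁅ v ⁆))) ⟨
  ⟨ ∂₀ f , g ⟩ ∎

∂₀-cong : ∀ {n} {f g : Vector n} → (∀ σ → f σ ≡ g σ) → ∀ τ → ∂₀ f τ ≡ ∂₀ g τ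
∂₀-cong f≗g τ = sum-cong-≗ (λ v → cong (not (lookup τ v) ∧_) (f≗g (τ ∪ ⁅ v ⁆)))

∂₀-⊕ : ∀ {n} (f g : Vector n) τ → ∂₀ (f ⊕ g) τ ≡ ∂₀ f τ xor ∂₀ g τ
∂₀-⊕ f g τ = trans
  (sum-cong-≗ (λ v → ∧-distribˡ-xor (not (lookup τ v)) (f (τ ∪ ⁅ v ⁆)) (g (τ ∪ ⁅ v ⁆))))
  (∑-distrib-+ (λ v → not (lookup τ v) ∧ f (τ ∪ ⁅ v ⁆)) _)

∂₀-zero : ∀ {n} (τ : Subset n) → ∂₀ (λ _ → false) τ ≡ false
∂₀-zero {n} τ = trans (sum-cong-≗ (λ v → ∧-zeroʳ (not (lookup τ v)))) (sum-replicate-zero n)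

lookup-⊥ : ∀ {n} (v : Fin n) → lookup ⊥ v ≡ false
lookup-⊥ zero    = refl
lookup-⊥ (suc v) = lookup-⊥ v

lookup-⁅⁆-comm : ∀ {n} (v w : Fin n) → lookup ⁅ v ⁆ w ≡ lookup ⁅ w ⁆ v
lookup-⁅⁆-comm zero    zero    = refl
lookup-⁅⁆-comm zero    (suc w) = lookup-⊥ w
lookup-⁅⁆-comm (suc v) zero    = sym (lookup-⊥ v)
lookup-⁅⁆-comm (suc v) (suc w) = lookup-⁅⁆-comm v w

lookup-⁅⁆-self : ∀ {n} (v : Fin n) → lookup ⁅ v ⁆ v ≡ true
lookup-⁅⁆-self zero    = refl
lookup-⁅⁆-self (suc v) = lookup-⁅⁆-self v

∣∪⁅⁆∣ : ∀ {n} (σ : Subset n) v → not (lookup σ v) ≡ true → ∣ σ ∪ ⁅ v ⁆ ∣ ≡ ℕ.suc ∣ σ ∣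
∣∪⁅⁆∣ (outside ∷ σ) zero    _ = cong (ℕ.suc ∘ ∣_∣) (∪-identityʳ σ)
∣∪⁅⁆∣ (inside  ∷ σ) (suc v) e = cong ℕ.suc (∣∪⁅⁆∣ σ v e)
∣∪⁅⁆∣ (outside ∷ σ) (suc v) e = ∣∪⁅⁆∣ σ v e

-- Inserting first v and then w into τ gives the same subset as inserting
-- them in the other order, so the terms cancel in pairs.
∂₀-∂₀ : ∀ {n} (f : Vector n) τ → ∂₀ (∂₀ f) τ ≡ false
∂₀-∂₀ {n} f τ = trans
  (sum-cong-≗ (λ v → *-distribˡ-sum (not (lookup τ v))
    (λ w → not (lookup (τ ∪ ⁅ v ⁆) w) ∧ f ((τ ∪ ⁅ v ⁆) ∪ ⁅ w ⁆))))
  (trans (sum-cong-≗ (λ v → sum-cong-≗ (λ w → sym (a-eq v w)))) (sum-symmetric a a-sym a-diag))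
  where
  a : Fin n → Fin n → Bool
  a v w = not (lookup τ v) ∧ (not (lookup τ w ∨ lookup ⁅ v ⁆ w) ∧ f (τ ∪ (⁅ v ⁆ ∪ ⁅ w ⁆)))
  a-eq : ∀ v w → a v w ≡
    not (lookup τ v) ∧ (not (lookup (τ ∪ ⁅ v ⁆) w) ∧ f ((τ ∪ ⁅ v ⁆) ∪ ⁅ w ⁆))
  a-eq v w = cong₂ (λ x σ → not (lookup τ v) ∧ (not x ∧ f σ))
    (sym (lookup-zipWith _∨_ w τ ⁅ v ⁆)) (sym (∪-assoc τ ⁅ v ⁆ ⁅ w ⁆))
  swap : ∀ x y z u → not x ∧ (not (y ∨ z) ∧ u) ≡ not y ∧ (not (x ∨ z) ∧ u)
  swap true  true  z u = refl
  swap true  false z u = refl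
  swap false true  z u = refl
  swap false false z u = refl
  a-sym : ∀ v w → a v w ≡ a w v
  a-sym v w = trans (swap (lookup τ v) (lookup τ w) _ _)
    (cong₂ (λ x σ → not (lookup τ w) ∧ (not (lookup τ v ∨ x) ∧ f (τ ∪ σ)))
      (lookup-⁅⁆-comm v w) (∪-comm ⁅ v ⁆ ⁅ w ⁆))
  diag : ∀ x u → not x ∧ (not (x ∨ true) ∧ u) ≡ false
  diag true  u = refl
  diag false u = refl
  a-diag : ∀ v → a v v ≡ false
  a-diag v = trans (cong (λ x → not (lookup τ v) ∧ (not (lookup τ v ∨ x) ∧ f (τ ∪ (⁅ v ⁆ ∪ ⁅ v ⁆))))
    (lookup-⁅⁆-self v)) (diag (lookup τ v) _)

module _ {n : ℕ} (K : SimplicialComplex n) where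
  open SimplicialComplex K

  private variable p : ℕ

  -- Chains of K

  -- Since chains are supported on p-simplices, the restriction in the
  -- definitions of ∂ and δ is invisible when paired with a chain.
  restrict-∧ : ∀ (c : Chain K p) f σ → coeff c σ ∧ coeff (restrict K p f) σ ≡ coeff c σ ∧ f σ
  restrict-∧ {p} c f σ with coeff c σ in cσ
  ... | false = refl
  ... | true  = cong (_∧ f σ) (dec-true (simplex? K p σ) (supported c cσ))

  restrict-supported : ∀ f σ → (f σ ≡ true → Simplex K p σ) → coeff (restrict K p f) σ ≡ f σ
  restrict-supported {p} f σ sup with f σ
  ... | false = ∧-zeroʳ _
  ... | true  = cong (_∧ true) (dec-true (simplex? K p σ) (sup refl))

  coeff-0ᶜ : ∀ σ → coeff (0ᶜ K {p}) σ ≡ false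
  coeff-0ᶜ σ = ∧-zeroʳ _

  coeff-+ᶜ : ∀ (c d : Chain K p) σ → coeff (_+ᶜ_ K c d) σ ≡ coeff c σ xor coeff d σ
  coeff-+ᶜ {p} c d σ = restrict-supported (λ τ → coeff c τ xor coeff d τ) σ sup
    where
    sup : coeff c σ xor coeff d σ ≡ true → Simplex K p σ
    sup e with coeff c σ in cσ
    ... | true  = supported c cσ
    ... | false = supported d e

  ∂-+ᶜ : ∀ (c d : Chain K (ℕ.suc p)) τ →
    coeff (∂ K (_+ᶜ_ K c d)) τ ≡ coeff (∂ K c) τ xor coeff (∂ K d) τ
  ∂-+ᶜ {p} c d τ = trans
    (cong (s ∧_) (trans (∂₀-cong (coeff-+ᶜ c d) τ) (∂₀-⊕ (coeff c) (coeff d) τ)))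
    (∧-distribˡ-xor s _ _)
    where s = does (simplex? K p τ)

  ∂-0ᶜ : ∀ τ → coeff (∂ K (0ᶜ K {ℕ.suc p})) τ ≡ false
  ∂-0ᶜ {p} τ = trans (cong (s ∧_) (trans (∂₀-cong coeff-0ᶜ τ) (∂₀-zero τ))) (∧-zeroʳ s)
    where s = does (simplex? K p τ)

  -- The facets of simplices of d are simplices, except that the empty set
  -- must be excluded.
  ∂₀-supported : ∀ (d : Chain K (ℕ.suc p)) {τ} → Nonempty τ →
    ∂₀ (coeff d) τ ≡ true → Simplex K p τ
  ∂₀-supported d {τ} τ≠∅ ∂dτ with sum-true _ ∂dτ
  ... | v , e with supported d (∧-trueʳ {not (lookup τ v)} e)
  ...   | face , size = down-closed face τ≠∅ (p⊆p∪q ⁅ v ⁆) ,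
    ℕ.suc-injective (trans (sym (∣∪⁅⁆∣ τ v (∧-trueˡ e))) size)

  -- Hence restricting ∂ d to simplices has no effect on the terms of ∂ (∂ d).
  restrict-∂-invisible : ∀ (d : Chain K (ℕ.suc (ℕ.suc p))) τ v →
    not (lookup τ v) ∧ coeff (∂ K d) (τ ∪ ⁅ v ⁆) ≡ not (lookup τ v) ∧ ∂₀ (coeff d) (τ ∪ ⁅ v ⁆)
  restrict-∂-invisible d τ v with lookup τ v
  ... | true  = refl
  ... | false = restrict-supported (∂₀ (coeff d)) _
    (∂₀-supported d (v , q⊆p∪q τ ⁅ v ⁆ (x∈⁅x⁆ v)))

  ∂-∂ : ∀ (d : Chain K (ℕ.suc (ℕ.suc p))) → IsCycle K (∂ K d)
  ∂-∂ {p} d τ = cong (does (simplex? K p τ) ∧_)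
    (trans (sum-cong-≗ (restrict-∂-invisible d τ)) (∂₀-∂₀ (coeff d) τ))

  ⟨⟩-δ-∂ : ∀ (c : Chain K p) (d : Chain K (ℕ.suc p)) →
    ⟨ coeff (δ K c) , coeff d ⟩ ≡ ⟨ coeff c , coeff (∂ K d) ⟩
  ⟨⟩-δ-∂ c d = begin
    ⟨ coeff (δ K c) , coeff d ⟩       ≡⟨ ⟨⟩-comm (coeff (δ K c)) (coeff d) ⟩
    ⟨ coeff d , coeff (δ K c) ⟩       ≡⟨ Σₛ-cong (restrict-∧ d (δ₀ (coeff c))) ⟩
    ⟨ coeff d , δ₀ (coeff c) ⟩        ≡⟨ ⟨⟩-δ₀-∂₀ (coeff d) (coeff c) ⟩
    ⟨ ∂₀ (coeff d) , coeff c ⟩        ≡⟨ ⟨⟩-comm (∂₀ (coeff d)) (coeff c) ⟩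
    ⟨ coeff c , ∂₀ (coeff d) ⟩        ≡⟨ Σₛ-cong (restrict-∧ c (∂₀ (coeff d))) ⟨
    ⟨ coeff c , coeff (∂ K d) ⟩       ∎

  -- The chain consisting of σ alone, or zero if σ is not a p-simplex.
  simplexChain : ∀ p → Subset n → Chain K p
  simplexChain p σ = restrict K p (single σ)

  -- The adjunction applied to a single simplex.  If σ is not a
  -- (p + 1)-simplex, both sides vanish.
  coeff-δ : ∀ (c : Chain K p) σ →
    coeff (δ K c) σ ≡ ⟨ coeff c , coeff (∂ K (simplexChain (ℕ.suc p) σ)) ⟩
  coeff-δ c σ = begin
    coeff (δ K c) σ                                   ≡⟨ ⟨⟩-single σ _ ⟨
    ⟨ single σ , coeff (δ K c) ⟩                      ≡⟨ ⟨⟩-comm (single σ) (coeff (δ K c)) ⟩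
    ⟨ coeff (δ K c) , single σ ⟩                      ≡⟨ Σₛ-cong (restrict-∧ (δ K c) (single σ)) ⟨
    ⟨ coeff (δ K c) , coeff (simplexChain _ σ) ⟩      ≡⟨ ⟨⟩-δ-∂ c (simplexChain _ σ) ⟩
    ⟨ coeff c , coeff (∂ K (simplexChain _ σ)) ⟩      ∎

  cocycle-∂ : ∀ (c : Chain K (ℕ.suc p)) → IsCocycle K c → ∀ d →
    ⟨ coeff c , coeff (∂ K d) ⟩ ≡ false
  cocycle-∂ c δc≈0 d = begin
    ⟨ coeff c , coeff (∂ K d) ⟩   ≡⟨ ⟨⟩-δ-∂ c d ⟨
    ⟨ coeff (δ K c) , coeff d ⟩   ≡⟨ ⟨⟩-comm (coeff (δ K c)) (coeff d) ⟩
    ⟨ coeff d , coeff (δ K c) ⟩   ≡⟨ ⟨⟩-zeroʳ (coeff d) _ (λ σ → trans (δc≈0 σ) (coeff-0ᶜ σ)) ⟩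
    false                         ∎

  coboundary-cycle : ∀ (c z : Chain K (ℕ.suc p)) → IsCoboundary K c → IsCycle K z →
    ⟨ coeff c , coeff z ⟩ ≡ false
  coboundary-cycle c z (d , δd≈c) ∂z≈0 = begin
    ⟨ coeff c , coeff z ⟩         ≡⟨ Σₛ-cong (λ σ → cong (_∧ coeff z σ) (δd≈c σ)) ⟨
    ⟨ coeff (δ K d) , coeff z ⟩   ≡⟨ ⟨⟩-δ-∂ d z ⟩
    ⟨ coeff d , coeff (∂ K z) ⟩   ≡⟨ ⟨⟩-zeroʳ (coeff d) _ (λ σ → trans (∂z≈0 σ) (coeff-0ᶜ σ)) ⟩
    false                         ∎

  cocycle-homologous : ∀ (c z ζ : Chain K (ℕ.suc p)) → IsCocycle K c → Homologous K z ζ →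
    ⟨ coeff c , coeff z ⟩ ≡ ⟨ coeff c , coeff ζ ⟩
  cocycle-homologous c z ζ cocyc (d , ∂d≈z+ζ) = xor≡false⇒≡ (begin
    ⟨ coeff c , coeff z ⟩ xor ⟨ coeff c , coeff ζ ⟩
      ≡⟨ ⟨⟩-⊕ʳ (coeff c) (coeff z) (coeff ζ) ⟨
    ⟨ coeff c , coeff z ⊕ coeff ζ ⟩
      ≡⟨ Σₛ-cong (λ σ → cong (coeff c σ ∧_) (trans (∂d≈z+ζ σ) (coeff-+ᶜ z ζ σ))) ⟨
    ⟨ coeff c , coeff (∂ K d) ⟩
      ≡⟨ cocycle-∂ c cocyc d ⟩
    false ∎)

  -- Solution sets and cocycles

  cocycle⇒solution : ∀ (ζ η : Chain K 1) → IsCocycle K η →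
    ⟨ coeff η , coeff ζ ⟩ ≡ true → IsSolutionSet K ζ η
  cocycle⇒solution ζ η cocyc ηζ z _ z~ζ
    with Σₛ-true (trans (cocycle-homologous η z ζ cocyc z~ζ) ηζ)
  ... | e , ηe∧ze = e , ∧-trueʳ ηe∧ze , ∧-trueˡ ηe∧ze

  solution⇒cocycle : ∀ (ζ S : Chain K 1) → IsCycle K ζ → IsSolutionSet K ζ S →
    ∃ λ η → _⊆ᶜ_ K η S × IsCocycle K η × ⟨ coeff η , coeff ζ ⟩ ≡ true
  solution⇒cocycle ζ S ∂ζ≈0 hits = conclude
    (separate subspace gens (All.map⁺ (All.universal gen∈ (subsets n))) (coeff S ⊙ coeff ζ))
    where
    -- The functions that agree with a boundary on S and vanish off S.
    Bounds : Vector n → Set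
    Bounds f = ∃ λ (d : Chain K 2) → ∀ σ → f σ ≡ coeff S σ ∧ coeff (∂ K d) σ

    subspace : IsSubspace Bounds
    subspace = record
      { resp  = λ f≗g (d , e) → d , λ σ → trans (sym (f≗g σ)) (e σ)
      ; zero∈ = 0ᶜ K , λ σ → sym (trans (cong (coeff S σ ∧_) (∂-0ᶜ σ)) (∧-zeroʳ _))
      ; ⊕∈    = λ (c , e) (d , e′) → _+ᶜ_ K c d , λ σ → trans (cong₂ _xor_ (e σ) (e′ σ))
          (trans (sym (∧-distribˡ-xor (coeff S σ) _ _)) (cong (coeff S σ ∧_) (sym (∂-+ᶜ c d σ))))
      }

    -- The parts in S of the boundaries of single triangles, which
    -- span Bounds; gen σ is zero if σ is not a triangle.
    gen : Subset n → Vector n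
    gen σ = coeff S ⊙ coeff (∂ K (simplexChain 2 σ))

    gens : List (Vector n)
    gens = map gen (subsets n)

    gen∈ : ∀ σ → Bounds (gen σ)
    gen∈ σ = simplexChain 2 σ , λ _ → refl

    conclude : Bounds (coeff S ⊙ coeff ζ) ⊎
        (∃ λ φ → All (λ g → ⟨ φ , g ⟩ ≡ false) gens × ⟨ φ , coeff S ⊙ coeff ζ ⟩ ≡ true) →
      ∃ λ η → _⊆ᶜ_ K η S × IsCocycle K η × ⟨ coeff η , coeff ζ ⟩ ≡ true
    conclude (inj₁ (d , ζ≡∂d)) = contradiction (trans (sym z∌e) z∋e) λ ()
      where
      z : Chain K 1
      z = _+ᶜ_ K ζ (∂ K d)

      z-cycle : IsCycle K z
      z-cycle τ = trans (∂-+ᶜ ζ (∂ K d) τ) (trans (cong₂ _xor_ (∂ζ≈0 τ) (∂-∂ d τ))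
        (trans (xor-same (coeff (0ᶜ K) τ)) (sym (coeff-0ᶜ τ))))

      z~ζ : Homologous K z ζ
      z~ζ = d , λ σ → sym (begin
        coeff (_+ᶜ_ K z ζ) σ                            ≡⟨ coeff-+ᶜ z ζ σ ⟩
        coeff z σ xor coeff ζ σ                         ≡⟨ cong (_xor coeff ζ σ) (coeff-+ᶜ ζ (∂ K d) σ) ⟩
        (coeff ζ σ xor coeff (∂ K d) σ) xor coeff ζ σ   ≡⟨ cong (_xor coeff ζ σ) (xor-comm (coeff ζ σ) _) ⟩
        (coeff (∂ K d) σ xor coeff ζ σ) xor coeff ζ σ   ≡⟨ xor-cancelʳ _ (coeff ζ σ) ⟩
        coeff (∂ K d) σ                                 ∎)

      hit = hits z z-cycle z~ζ
      e = proj₁ hit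

      z∋e : coeff z e ≡ true
      z∋e = proj₁ (proj₂ hit)

      ζe≡∂de : coeff ζ e ≡ coeff (∂ K d) e
      ζe≡∂de = subst (λ s → s ∧ coeff ζ e ≡ s ∧ coeff (∂ K d) e) (proj₂ (proj₂ hit)) (ζ≡∂d e)

      z∌e : coeff z e ≡ false
      z∌e = trans (coeff-+ᶜ ζ (∂ K d) e)
        (trans (cong (_xor coeff (∂ K d) e) ζe≡∂de) (xor-same (coeff (∂ K d) e)))
    conclude (inj₂ (φ , φ⊥gens , φζ)) = η , ∧-trueʳ , η-cocycle , trans (move (coeff ζ)) φζ
      where
      η : Chain K 1
      η .coeff     = φ ⊙ coeff S
      η .supported = supported S ∘ ∧-trueʳ

      -- Intersection with S moves across the pairing.
      move : ∀ f → ⟨ coeff η , f ⟩ ≡ ⟨ φ , coeff S ⊙ f ⟩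
      move f = Σₛ-cong (λ σ → ∧-assoc (φ σ) (coeff S σ) (f σ))

      η-cocycle : IsCocycle K η
      η-cocycle σ = begin
        coeff (δ K η) σ                                     ≡⟨ coeff-δ η σ ⟩
        ⟨ coeff η , coeff (∂ K (simplexChain 2 σ)) ⟩        ≡⟨ move _ ⟩
        ⟨ φ , gen σ ⟩                                       ≡⟨ All.lookup φ⊥gens (∈-map⁺ gen (∈-subsets σ)) ⟩
        false                                               ≡⟨ coeff-0ᶜ σ ⟨
        coeff (0ᶜ K) σ                                      ∎

theorem13 : ∀ {n : ℕ} (K : SimplicialComplex n) → IsClosedSurface K →
    ∀ (ζ : Chain K 1) → IsNontrivialCycle K ζ →
    ∀ (S : Chain K 1) → IsMinimalSolutionSet K ζ S →
    IsNontrivialCocycle K S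
theorem13 K _ ζ (ζ-cycle , _) S (S-solves , S-minimal)
  with η , η⊆S , η-cocycle , ηζ ← solution⇒cocycle K ζ S ζ-cycle S-solves =
  S-cocycle , S-nontrivial
  where
  -- An edge of S outside η would make η a solution set properly contained
  -- in S.
  S≈η : ∀ σ → coeff S σ ≡ coeff η σ
  S≈η σ with coeff S σ in Sσ | coeff η σ in ησ
  ... | true  | true  = refl
  ... | false | false = refl
  ... | false | true  = contradiction (trans (sym Sσ) (η⊆S ησ)) λ ()
  ... | true  | false = contradiction (cocycle⇒solution K ζ η η-cocycle ηζ)
    (S-minimal η (η⊆S , σ , Sσ , λ ησ′ → contradiction (trans (sym ησ) ησ′) λ ()))

  S-pairing : ∀ f → ⟨ coeff S , f ⟩ ≡ ⟨ coeff η , f ⟩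
  S-pairing f = Σₛ-cong (λ σ → cong (_∧ f σ) (S≈η σ))

  S-cocycle : IsCocycle K S
  S-cocycle σ = begin
    coeff (δ K S) σ    ≡⟨ coeff-δ K S σ ⟩
    ⟨ coeff S , _ ⟩    ≡⟨ S-pairing _ ⟩
    ⟨ coeff η , _ ⟩    ≡⟨ coeff-δ K η σ ⟨
    coeff (δ K η) σ    ≡⟨ η-cocycle σ ⟩
    coeff (0ᶜ K) σ     ∎

  S-nontrivial : ¬ IsCoboundary K S
  S-nontrivial S-cobounds = contradiction
    (trans (sym (coboundary-cycle K S ζ S-cobounds ζ-cycle)) (trans (S-pairing (coeff ζ)) ηζ)) λ ()
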